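{- For every positive integer $n$, the set of monomials $B_n^{(1,2)}$ has cardinality $2^{n-1}\, n!$.
   Context: A modified Motzkin path of length $n$ is a lattice path $\pi=(p_1,\ldots,p_n)$ in $\mathbb{Z}^2$ starting at $(0,0)$ whose $i$-th step $p_i$ is one of: an (undecorated) up-step $(1,1)$; a horizontal step $(1,0)$ with decoration $\theta_i$; a horizontal step $(1,0)$ with decoration $\xi_i$; a down-step $(1,-1)$ with decoration $\theta_i\xi_i$; such that the first step is an up-step and afterwards the path never goes below the line $y=1$. The set of these paths is $\Pi(n)_{>0}$. For $\pi\in\Pi(n)_{>0}$ let $T(\pi)$ (resp. $S(\pi)$) be the set of indices $i$ such that $\theta_i$ (resp. $\xi_i$) occurs in the decoration of $p_i$; both are subsets of $\{2,\ldots,n\}$. For $T,S\subseteq\{2,\ldots,n\}$ define $\alpha(T,S)=(\alpha_1(T,S),\ldots,\alpha_n(T,S))$ by $\alpha_1(T,S)=0$ and, for $2\le i\le n$, $\alpha_i(T,S)=\alpha_{i-1}(T,S)-1+\chi(i\notin T)+\chi(i\notin S)$, where $\chi(P)=1$ if $P$ is true and $0$ otherwise. The variables $x_1,\dots,x_n$ commute with all variables; the variables $\theta_1,\ldots,\theta_n,\xi_1,\ldots,\xi_n$ anticommute with one another (so $\theta_i^2=\xi_i^2=0$). For $T=\{t_1<\cdots<t_k\}$, $\theta_T=\theta_{t_1}\cdots\theta_{t_k}$, and similarly $\xi_S$; $x^\alpha=x_1^{\alpha_1}\cdots x_n^{\alpha_n}$. Then $B_n^{(1,2)}$ is the set of monomials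 $x^\alpha\theta_T\xi_S$ such that $(T,S)=(T(\pi),S(\pi))$ for some $\pi\in\Pi(n)_{>0}$ and $0\le\alpha_i\le\alpha_i(T,S)$ for all $i\in\{1,\ldots,n\}$. (Signs of monomials are irrelevant; an element of $B_n^{(1,2)}$ is determined by the triple $(\alpha,T,S)$.) -}

module Defs where

open import Data.Fin.Base using (Fin; zero; suc; toℕ)
open import Data.Fin.Subset using (Subset; Side; inside; outside)
open import Data.Integer.Base using (ℤ; +_; 0ℤ; 1ℤ; -1ℤ; _+_; _-_; _≤_)
open import Data.Nat.Base using (ℕ; suc)
open import Data.Product.Base using (_×_; _,_; proj₁; proj₂; ∃-syntax)
open import Data.Vec.Base using (Vec; []; _∷_; lookup; map)
open import Function.Bundles using (Bijection)
open import Level using (Level; _⊔_)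
open import Relation.Binary.Construct.On as On using ()
open import Relation.Binary.PropositionalEquality using (_≡_; setoid)
open import Relation.Unary using (Pred)

private
  variable
    a ℓ : Level
    n : ℕ

-- Throughout, the index i ∈ {1,…,n} is represented by the element of Fin n
-- whose value is i − 1.

-- The subscript of a decoration is the position of the step in the path, so it
-- is not stored in the step.

data Step : Set where
  up           : Step
  horizontal-θ : Step
  horizontal-ξ : Step
  down-θξ      : Step

displacement : Step → ℤ × ℤ
displacement up           = 1ℤ , 1ℤ
displacement horizontal-θ = 1ℤ , 0ℤ
displacement horizontal-ξ = 1ℤ , 0ℤ
displacement down-θξ      = 1ℤ , -1ℤ

_⊕_ : ℤ × ℤ → ℤ × ℤ → ℤ × ℤ
(x , y) ⊕ (x′ , y′) = (x + x′) , (y + y′)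

-- vertex π k is the lattice point reached after k steps.

vertex : Vec Step n → Fin (suc n) → ℤ × ℤ
vertex π       zero    = 0ℤ , 0ℤ
vertex (p ∷ π) (suc k) = displacement p ⊕ vertex π k

-- The set Π(n)_{>0}, as a predicate on step sequences.

record IsModifiedMotzkin {n : ℕ} (π : Vec Step n) : Set where
  field
    first-up : ∀ (i : Fin n) → toℕ i ≡ 0 → lookup π i ≡ up
    above    : ∀ (i : Fin n) → 1ℤ ≤ proj₂ (vertex π (suc i))

θ-part : Step → Side
θ-part up           = outside
θ-part horizontal-θ = inside
θ-part horizontal-ξ = outside
θ-part down-θξ      = inside

ξ-part : Step → Side
ξ-part up           = outside
ξ-part horizontal-θ = outside
ξ-part horizontal-ξ = inside
ξ-part down-θξ      = inside

T⟨_⟩ : Vec Step n → Subset n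
T⟨ π ⟩ = map θ-part π

S⟨_⟩ : Vec Step n → Subset n
S⟨ π ⟩ = map ξ-part π

-- χ(i ∉ T), given the entry of T at i.

χ∉ : Side → ℤ
χ∉ inside  = 0ℤ
χ∉ outside = 1ℤ

-- recurrence c T S lists the successive values of
-- αᵢ = αᵢ₋₁ − 1 + χ(i ∉ T) + χ(i ∉ S), where c is the value preceding the
-- first entry.

recurrence : ℤ → Subset n → Subset n → Vec ℤ n
recurrence c []      []      = []
recurrence c (t ∷ T) (s ∷ S) = c′ ∷ recurrence c′ T S
  where
  c′ : ℤ
  c′ = c - 1ℤ + χ∉ t + χ∉ s

-- The sequence α(T,S), defined for T, S ⊆ {2,…,n}; the entries of T and S at
-- the index 1 are ignored. Its terms can be negative for arbitrary T and S.

α⟨_,_⟩ : Subset n → Subset n → Vec ℤ n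
α⟨ []    , []    ⟩ = []
α⟨ _ ∷ T , _ ∷ S ⟩ = 0ℤ ∷ recurrence 0ℤ T S

-- The monomial x^α θ_T ξ_S, up to sign.

record Monomial (n : ℕ) : Set where
  constructor x^_θ_ξ_
  field
    exponents : Vec ℕ n
    θ-set     : Subset n
    ξ-set     : Subset n

B⁽¹²⁾ : (n : ℕ) → Pred (Monomial n) _
B⁽¹²⁾ n (x^ α θ T ξ S) =
  (∃[ π ] IsModifiedMotzkin {n} π × T ≡ T⟨ π ⟩ × S ≡ S⟨ π ⟩) ×
  (∀ (i : Fin n) → + lookup α i ≤ lookup α⟨ T , S ⟩ i)

-- Elements of Σ A P are compared by their first components only, so different
-- proofs of P x do not count as different elements.

HasCardinality : {A : Set a} → Pred A ℓ → ℕ → Set (a ⊔ ℓ)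
HasCardinality {A = A} P k =
  Bijection (setoid (Fin k)) (On.setoid (setoid A) (proj₁ {B = P}))

{-# OPTIONS --safe #-}
-- Since αᵢ(T,S) is one less than the height of the path after i steps, the
-- monomials are the paths weighted by the product of the αᵢ + 1.  Let W m c be
-- the weight of the continuations of length m from α = c, so that W (1 + m) = L (W m)
-- with L f c = (c + 2) f(c + 1) + 2 (c + 1) f(c) + c f(c − 1).  The binomial
-- transform F k f = Σ_c (k choose c) f(c) satisfies F k (L f) = (k + 2) F (k + 1) f,
-- because the paths of length k ending at α = c have total weight
-- (k + 1)! (k choose c).  Iterating from F k (W 0) = 2ᵏ gives
-- W m 0 = F 0 (W m) = 2ᵐ (m + 1)!.

module Submission where

open import Data.Fin.Base using (Fin; zero; suc; toℕ; fromℕ<)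
open import Data.Fin.Properties using (toℕ<n; toℕ-fromℕ<; toℕ-injective; *↔×; +↔⊎; 1↔⊤)
open import Data.Fin.Subset using (outside)
open import Data.Integer.Base as ℤ using (ℤ; +_; 0ℤ; 1ℤ; -1ℤ)
import Data.Integer.Properties as ℤ
open import Data.Nat.Base using (ℕ; zero; suc; pred; NonZero; _+_; _∸_; _*_; _^_; _!; _<_; s≤s; z≤n)
open import Data.Nat.Properties using (+-suc; +-identityʳ; *-comm)
open import Data.Nat.Tactic.RingSolver using (solve-∀)
open import Data.Product.Base using (Σ-syntax; ∃-syntax; _×_; _,_; proj₁; proj₂)
open import Data.Product.Function.NonDependent.Propositional using (_×-↔_)
open import Data.Sum.Base using (_⊎_; inj₁; inj₂)
open import Data.Sum.Function.Propositional using (_⊎-↔_)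
open import Data.Unit.Base using (⊤; tt)
open import Data.Vec.Base using (Vec; []; _∷_; lookup)
open import Data.Vec.Properties using (∷-injective)
open import Function.Base using (_∘_)
open import Function.Bundles using (_↔_; Injection; Inverse; mk↔ₛ′)
open import Function.Construct.Composition using (_↔-∘_)
open import Function.Properties.Inverse using (↔-refl; ↔⇒↣)
open import Relation.Binary.PropositionalEquality
open import Defs

private
  variable
    m : ℕ

-- Step weights and the operator `L`.

infix 5 _↑_

_↑_ : ℕ → Step → ℕ
c ↑ up           = suc c
c ↑ horizontal-θ = c
c ↑ horizontal-ξ = c
c ↑ down-θξ      = pred c

-- The number of exponents allowed after the step; it vanishes exactly for the
-- forbidden step down from c = 0, where _↑_ has a junk value.
choices : ℕ → Step → ℕ
choices c up           = suc (suc c)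
choices c horizontal-θ = suc c
choices c horizontal-ξ = suc c
choices c down-θξ      = c

sumSteps : (Step → ℕ) → ℕ
sumSteps g = g up + (g horizontal-θ + (g horizontal-ξ + g down-θξ))

L : (ℕ → ℕ) → ℕ → ℕ
L f c = sumSteps λ p → choices c p * f (c ↑ p)

W : ℕ → ℕ → ℕ
W zero    _ = 1
W (suc m)   = L (W m)

-- The binomial transform and the value of `W m 0`.

-- Pascal's rule unrolled: this is Σ_c (k choose c) f(c), with no binomial coefficients to
-- manipulate.
binomialSum : ℕ → (ℕ → ℕ) → ℕ
binomialSum zero    f = f 0
binomialSum (suc k) f = binomialSum k f + binomialSum k (f ∘ suc)

binomialSum-cong : ∀ k {f g} → f ≗ g → binomialSum k f ≡ binomialSum k g
binomialSum-cong zero    f≗g = f≗g 0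
binomialSum-cong (suc k) f≗g =
  cong₂ _+_ (binomialSum-cong k f≗g) (binomialSum-cong k (f≗g ∘ suc))

binomialSum-+ : ∀ k f g →
  binomialSum k (λ c → f c + g c) ≡ binomialSum k f + binomialSum k g
binomialSum-+ zero    f g = refl
binomialSum-+ (suc k) f g = trans
  (cong₂ _+_ (binomialSum-+ k f g) (binomialSum-+ k (f ∘ suc) (g ∘ suc)))
  (interchange (binomialSum k f) (binomialSum k g) (binomialSum k (f ∘ suc)) (binomialSum k (g ∘ suc)))
  where
  interchange : ∀ a b c d → (a + b) + (c + d) ≡ (a + c) + (b + d)
  interchange = solve-∀

-- Raising `c` by one raises each of the four weights by one, which accounts for the correction f(c)
-- + 2 f(c + 1) + f(c + 2); it is grouped as a twofold Pascal sum. At `c = 0` the junk value of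
-- `pred` on the right has coefficient 0.
L-suc : ∀ f c → L f (suc c) ≡
  L (f ∘ suc) c + ((f c + f (suc c)) + (f (suc c) + f (suc (suc c))))
L-suc f zero = identity (f 0) (f 1) (f 2)
  where
  identity : ∀ x y z → 3 * z + (2 * y + (2 * y + 1 * x)) ≡
    (2 * z + (1 * y + (1 * y + 0 * y))) + ((x + y) + (y + z))
  identity = solve-∀
L-suc f c@(suc b) = identity c (f c) (f (suc c)) (f (suc (suc c)))
  where
  identity : ∀ c x y z →
    (3 + c) * z + ((2 + c) * y + ((2 + c) * y + (1 + c) * x)) ≡
    ((2 + c) * z + ((1 + c) * y + ((1 + c) * y + c * x))) + ((x + y) + (y + z))
  identity = solve-∀

-- Pascal's rule splits the left side into `L f` and its shift, and `L-suc` turns the shift into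
-- `L f′` plus a correction. The correction contributes `S + S′`, raising both factors `2 + k` from
-- the induction hypotheses to `3 + k`.
binomialSum-L : ∀ k f → binomialSum k (L f) ≡ (2 + k) * binomialSum (suc k) f
binomialSum-L zero f = identity (f 0) (f 1)
  where
  identity : ∀ x y → 2 * y + (1 * x + (1 * x + 0)) ≡ 2 * (x + y)
  identity = solve-∀
binomialSum-L (suc k) f = begin
  binomialSum k (L f) + binomialSum k (L f ∘ suc)
    ≡⟨ cong₂ _+_ refl (binomialSum-cong k (L-suc f)) ⟩
  binomialSum k (L f) + binomialSum k (λ c → L f′ c + (g c + g (suc c)))
    ≡⟨ cong₂ _+_ refl (binomialSum-+ k (L f′) (λ c → g c + g (suc c))) ⟩
  binomialSum k (L f) + (binomialSum k (L f′) + binomialSum k (λ c → g c + g (suc c)))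
    ≡⟨ cong₂ (λ a b → a + (b + binomialSum k (λ c → g c + g (suc c))))
         (binomialSum-L k f) (binomialSum-L k f′) ⟩
  (2 + k) * S + ((2 + k) * S′ + binomialSum k (λ c → g c + g (suc c)))
    -- By definition `binomialSum k g + binomialSum k (g ∘ suc)` is `binomialSum (suc k)
    -- g`, so additivity applies again at `suc k`.
    ≡⟨ cong (λ a → (2 + k) * S + ((2 + k) * S′ + a))
         (trans (binomialSum-+ k g (g ∘ suc)) (binomialSum-+ (suc k) f f′)) ⟩
  (2 + k) * S + ((2 + k) * S′ + (S + S′))
    ≡⟨ identity k S S′ ⟩
  (3 + k) * (S + S′) ∎
  where
  open ≡-Reasoning
  f′ g : ℕ → ℕ
  f′ = f ∘ suc
  g c = f c + f′ c
  S S′ : ℕ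
  S  = binomialSum (suc k) f
  S′ = binomialSum (suc k) f′
  identity : ∀ k x y → (2 + k) * x + ((2 + k) * y + (x + y)) ≡ (3 + k) * (x + y)
  identity = solve-∀

binomialSum-1 : ∀ k → binomialSum k (λ _ → 1) ≡ 2 ^ k
binomialSum-1 zero    = refl
binomialSum-1 (suc k) =
  trans (cong₂ _+_ (binomialSum-1 k) (binomialSum-1 k)) (double (2 ^ k))
  where
  double : ∀ x → x + x ≡ 2 * x
  double = solve-∀

-- Removing one `L` trades a unit of `m` for a unit of `k`, so the induction needs all `k`, and
-- `m + k` is invariant. The factor `suc k !` absorbs the `2 + k` of `binomialSum-L`.
binomialSum-W : ∀ m k → suc k ! * binomialSum k (W m) ≡ 2 ^ (m + k) * suc (m + k) !
binomialSum-W zero k =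
  trans (cong (suc k ! *_) (binomialSum-1 k)) (*-comm (suc k !) (2 ^ k))
binomialSum-W (suc m) k = begin
  suc k ! * binomialSum k (L (W m))
    ≡⟨ cong (suc k ! *_) (binomialSum-L k (W m)) ⟩
  suc k ! * ((2 + k) * binomialSum (suc k) (W m))
    ≡⟨ regroup (suc k !) (2 + k) (binomialSum (suc k) (W m)) ⟩
  suc (suc k) ! * binomialSum (suc k) (W m)
    ≡⟨ binomialSum-W m (suc k) ⟩
  2 ^ (m + suc k) * suc (m + suc k) !
    ≡⟨ cong (λ j → 2 ^ j * suc j !) (+-suc m k) ⟩
  2 ^ suc (m + k) * suc (suc (m + k)) ! ∎
  where
  open ≡-Reasoning
  regroup : ∀ x y z → x * (y * z) ≡ (y * x) * z
  regroup = solve-∀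

W-0 : ∀ m → W m 0 ≡ 2 ^ m * suc m !
W-0 m = begin
  W m 0                         ≡⟨ +-identityʳ (W m 0) ⟨
  1 ! * binomialSum 0 (W m)     ≡⟨ binomialSum-W m 0 ⟩
  2 ^ (m + 0) * suc (m + 0) !   ≡⟨ cong (λ j → 2 ^ j * suc j !) (+-identityʳ m) ⟩
  2 ^ m * suc m !               ∎
  where open ≡-Reasoning

-- Weighted paths and their number.

-- The height condition is encoded in `Fin (choices c p)`, empty for the forbidden step; the type is
-- thus an iterated sum of products mirroring `W`.
WeightedPath : ℕ → ℕ → Set
WeightedPath zero    c = ⊤
WeightedPath (suc m) c = Σ[ p ∈ Step ] Fin (choices c p) × WeightedPath m (c ↑ p)

Σ-Step↔⊎ : (A : Step → Set) →
  (A up ⊎ A horizontal-θ ⊎ A horizontal-ξ ⊎ A down-θξ) ↔ (Σ[ p ∈ Step ] A p)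
Σ-Step↔⊎ A = mk↔ₛ′
  (λ { (inj₁ x) → _ , x ; (inj₂ (inj₁ x)) → _ , x
     ; (inj₂ (inj₂ (inj₁ x))) → _ , x ; (inj₂ (inj₂ (inj₂ x))) → _ , x })
  (λ { (up , x) → inj₁ x ; (horizontal-θ , x) → inj₂ (inj₁ x)
     ; (horizontal-ξ , x) → inj₂ (inj₂ (inj₁ x)) ; (down-θξ , x) → inj₂ (inj₂ (inj₂ x)) })
  (λ { (up , _) → refl ; (horizontal-θ , _) → refl
     ; (horizontal-ξ , _) → refl ; (down-θξ , _) → refl })
  (λ { (inj₁ _) → refl ; (inj₂ (inj₁ _)) → refl
     ; (inj₂ (inj₂ (inj₁ _))) → refl ; (inj₂ (inj₂ (inj₂ _))) → refl })

Fin↔Σ-Step : ∀ {g : Step → ℕ} {A : Step → Set} → (∀ p → Fin (g p) ↔ A p) →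
  Fin (sumSteps g) ↔ (Σ[ p ∈ Step ] A p)
Fin↔Σ-Step {A = A} e =
  Σ-Step↔⊎ A ↔-∘
  +-⊎-↔ (e up) (+-⊎-↔ (e horizontal-θ) (+-⊎-↔ (e horizontal-ξ) (e down-θξ)))
  where
  +-⊎-↔ : ∀ {j k} {X Y : Set} → Fin j ↔ X → Fin k ↔ Y → Fin (j + k) ↔ (X ⊎ Y)
  +-⊎-↔ f g = (f ⊎-↔ g) ↔-∘ +↔⊎

Fin-W↔WeightedPath : ∀ m c → Fin (W m c) ↔ WeightedPath m c
Fin-W↔WeightedPath zero    c = 1↔⊤
Fin-W↔WeightedPath (suc m) c =
  Fin↔Σ-Step λ p → (↔-refl ×-↔ Fin-W↔WeightedPath m (c ↑ p)) ↔-∘ *↔×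

steps : ∀ {m c} → WeightedPath m c → Vec Step m
steps {zero}  _           = []
steps {suc m} (p , _ , w) = p ∷ steps w

exponents : ∀ {m c} → WeightedPath m c → Vec ℕ m
exponents {zero}  _           = []
exponents {suc m} (_ , k , w) = toℕ k ∷ exponents w

steps-exponents-injective : ∀ {m c} (v w : WeightedPath m c) →
  steps v ≡ steps w → exponents v ≡ exponents w → v ≡ w
steps-exponents-injective {zero}  _ _ _ _ = refl
steps-exponents-injective {suc m} (p , j , v) (q , k , w) eq₁ eq₂
  with ∷-injective eq₁ | ∷-injective eq₂
... | refl , eq₁′ | j≡k , eq₂′
  with toℕ-injective j≡k | steps-exponents-injective v w eq₁′ eq₂′
... | refl | refl = refl

-- Heights and the sequence α(T,S).

height : Step → ℤ
height p = proj₂ (displacement p)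

-- A step with d of its two possible decorations rises by 1 - d, which is -1 plus the number of
-- missing ones.
recurrence-step : ∀ z p → z ℤ.- 1ℤ ℤ.+ χ∉ (θ-part p) ℤ.+ χ∉ (ξ-part p) ≡ z ℤ.+ height p
recurrence-step z up           = trans (ℤ.+-assoc (z ℤ.- 1ℤ) 1ℤ 1ℤ) (ℤ.+-assoc z -1ℤ (+ 2))
recurrence-step z horizontal-θ = trans (ℤ.+-assoc (z ℤ.- 1ℤ) 0ℤ 1ℤ) (ℤ.+-assoc z -1ℤ 1ℤ)
recurrence-step z horizontal-ξ = trans (ℤ.+-assoc (z ℤ.- 1ℤ) 1ℤ 0ℤ) (ℤ.+-assoc z -1ℤ 1ℤ)
recurrence-step z down-θξ      = trans (ℤ.+-assoc (z ℤ.- 1ℤ) 0ℤ 0ℤ) (ℤ.+-assoc z -1ℤ 0ℤ)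

lookup-recurrence : ∀ z (π : Vec Step m) i →
  lookup (recurrence z T⟨ π ⟩ S⟨ π ⟩) i ≡ z ℤ.+ proj₂ (vertex π (suc i))
lookup-recurrence z (p ∷ π) zero =
  trans (recurrence-step z p) (cong (ℤ._+_ z) (sym (ℤ.+-identityʳ (height p))))
lookup-recurrence z (p ∷ π) (suc i) = begin
  lookup (recurrence z′ T⟨ π ⟩ S⟨ π ⟩) i      ≡⟨ lookup-recurrence z′ π i ⟩
  z′ ℤ.+ y                                    ≡⟨ cong (ℤ._+ y) (recurrence-step z p) ⟩
  z ℤ.+ height p ℤ.+ y                        ≡⟨ ℤ.+-assoc z (height p) y ⟩
  z ℤ.+ (height p ℤ.+ y)                      ∎
  where
  open ≡-Reasoning
  z′ y : ℤ
  z′ = z ℤ.- 1ℤ ℤ.+ χ∉ (θ-part p) ℤ.+ χ∉ (ξ-part p)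
  y  = proj₂ (vertex π (suc i))

-- The element of `Fin (choices c p)` is evidence that the step is allowed: it excludes the step
-- down from 0, where `pred` gives the wrong value.
↑-height : ∀ c p → Fin (choices c p) → + c ℤ.+ height p ≡ + (c ↑ p)
↑-height c       up           _ = cong +_ (trans (+-suc c 0) (cong suc (+-identityʳ c)))
↑-height c       horizontal-θ _ = cong +_ (+-identityʳ c)
↑-height c       horizontal-ξ _ = cong +_ (+-identityʳ c)
↑-height (suc c) down-θξ      _ = refl

choices-sound : ∀ c p (k : Fin (choices c p)) → toℕ k < suc (c ↑ p)
choices-sound c       up           k = toℕ<n k
choices-sound c       horizontal-θ k = toℕ<n k
choices-sound c       horizontal-ξ k = toℕ<n k
choices-sound (suc c) down-θξ      k = toℕ<n k

choices-complete : ∀ c p {a} → + a ℤ.≤ + c ℤ.+ height p → a < choices c p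
choices-complete c up {a} a≤ =
  s≤s (ℤ.drop‿+≤+ (subst (+ a ℤ.≤_) (↑-height c up zero) a≤))
choices-complete c horizontal-θ {a} a≤ =
  s≤s (ℤ.drop‿+≤+ (subst (+ a ℤ.≤_) (↑-height c horizontal-θ zero) a≤))
choices-complete c horizontal-ξ {a} a≤ =
  s≤s (ℤ.drop‿+≤+ (subst (+ a ℤ.≤_) (↑-height c horizontal-ξ zero) a≤))
-- Here the bound reads `+ a ≤ -1`.
choices-complete zero    down-θξ ()
choices-complete (suc c) down-θξ a≤ = s≤s (ℤ.drop‿+≤+ a≤)

Bounded : ℤ → Vec Step m → Vec ℕ m → Set
Bounded z π α = ∀ i → + lookup α i ℤ.≤ lookup (recurrence z T⟨ π ⟩ S⟨ π ⟩) i

recurrence-↑ : ∀ c p → Fin (choices c p) →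
  + c ℤ.- 1ℤ ℤ.+ χ∉ (θ-part p) ℤ.+ χ∉ (ξ-part p) ≡ + (c ↑ p)
recurrence-↑ c p k = trans (recurrence-step (+ c) p) (↑-height c p k)

weightedPath-bounded : ∀ {m c} (w : WeightedPath m c) → Bounded (+ c) (steps w) (exponents w)
weightedPath-bounded {suc m} {c} (p , k , w) zero
  rewrite recurrence-↑ c p k with choices-sound c p k
... | s≤s k≤ = ℤ.+≤+ k≤
weightedPath-bounded {suc m} {c} (p , k , w) (suc i)
  rewrite recurrence-↑ c p k = weightedPath-bounded w i

-- Exponents are natural numbers, so the bound at each step forces the new value to be nonnegative;
-- the exponent itself then serves as the element of `Fin (choices c p)`.
bounded⇒weightedPath : ∀ {m} c (π : Vec Step m) α → Bounded (+ c) π α →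
  ∃[ w ] steps {m} {c} w ≡ π × exponents w ≡ α
bounded⇒weightedPath c []      []      b = tt , refl , refl
bounded⇒weightedPath c (p ∷ π) (a ∷ α) b =
  let w , πw , αw = bounded⇒weightedPath (c ↑ p) π α
                      (subst (λ z → Bounded z π α) (recurrence-↑ c p k) (b ∘ suc))
  in (p , k , w) , cong (p ∷_) πw , cong₂ _∷_ (toℕ-fromℕ< a<) αw
  where
  a< : a < choices c p
  a< = choices-complete c p (subst (+ a ℤ.≤_) (recurrence-step (+ c) p) (b zero))
  k : Fin (choices c p)
  k = fromℕ< a<

-- Weighted paths as monomials.

parts-injective : ∀ p q → θ-part p ≡ θ-part q → ξ-part p ≡ ξ-part q → p ≡ q
parts-injective up           up           _ _ = refl
parts-injective horizontal-θ horizontal-θ _ _ = refl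
parts-injective horizontal-ξ horizontal-ξ _ _ = refl
parts-injective down-θξ      down-θξ      _ _ = refl

-- The decorations at an index determine the step, so no monomial is counted for two paths.
T-S-injective : (π ρ : Vec Step m) → T⟨ π ⟩ ≡ T⟨ ρ ⟩ → S⟨ π ⟩ ≡ S⟨ ρ ⟩ → π ≡ ρ
T-S-injective []      []      _   _   = refl
T-S-injective (p ∷ π) (q ∷ ρ) eqT eqS =
  let t , T = ∷-injective eqT
      s , S = ∷-injective eqS
  in cong₂ _∷_ (parts-injective p q t s) (T-S-injective π ρ T S)

-- The heights of `π` are the recurrence values, which bound natural numbers from above and so are
-- nonnegative; the initial up-step adds 1.
bounded⇒isModifiedMotzkin : ∀ (π : Vec Step m) α → Bounded 0ℤ π α → IsModifiedMotzkin (up ∷ π)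
bounded⇒isModifiedMotzkin π α b = record
  { first-up = λ { zero _ → refl }
  ; above    = λ { zero    → ℤ.≤-refl
                 ; (suc i) → ℤ.+-monoʳ-≤ 1ℤ (nonNegative i) }
  }
  where
  nonNegative : ∀ i → 0ℤ ℤ.≤ proj₂ (vertex π (suc i))
  nonNegative i = subst (0ℤ ℤ.≤_)
    (trans (lookup-recurrence 0ℤ π i) (ℤ.+-identityˡ _))
    (ℤ.≤-trans (ℤ.+≤+ z≤n) (b i))

monomial : ∀ {c} → WeightedPath m c → Monomial (suc m)
monomial w = x^ (0 ∷ exponents w) θ (outside ∷ T⟨ steps w ⟩) ξ (outside ∷ S⟨ steps w ⟩)

monomial-injective : ∀ {c} (v w : WeightedPath m c) → monomial v ≡ monomial w → v ≡ w
monomial-injective v w eq = steps-exponents-injective v w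
  (T-S-injective _ _
    (proj₂ (∷-injective (cong Monomial.θ-set eq)))
    (proj₂ (∷-injective (cong Monomial.ξ-set eq))))
  (proj₂ (∷-injective (cong Monomial.exponents eq)))

monomial∈B : (w : WeightedPath m 0) → B⁽¹²⁾ (suc m) (monomial w)
monomial∈B w =
  (up ∷ steps w , bounded⇒isModifiedMotzkin (steps w) (exponents w) b , refl , refl) ,
  λ { zero → ℤ.≤-refl ; (suc i) → b i }
  where
  b : Bounded 0ℤ (steps w) (exponents w)
  b = weightedPath-bounded w

B⇒monomial : ∀ μ → B⁽¹²⁾ (suc m) μ → ∃[ w ] monomial {m} {0} w ≡ μ
B⇒monomial (x^ (a ∷ α) θ _ ξ _) ((p ∷ π , motzkin , refl , refl) , bound)
  -- The first step must be `up`, and α₁(T,S) = 0 forces the first exponent to be 0.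
  with IsModifiedMotzkin.first-up motzkin zero refl | bound zero
... | refl | ℤ.+≤+ z≤n with bounded⇒weightedPath 0 π α (bound ∘ suc)
... | w , refl , refl = w , refl

theorem3p7 : (n : ℕ) → .{{_ : NonZero n}} → HasCardinality (B⁽¹²⁾ n) (2 ^ (n ∸ 1) * n !)
theorem3p7 (suc m) = subst (HasCardinality (B⁽¹²⁾ (suc m))) (W-0 m) record
  { to        = λ i → monomial (to i) , monomial∈B (to i)
  ; cong      = cong (monomial ∘ to)
  ; bijective = (λ eq → Injection.injective (↔⇒↣ e) (monomial-injective _ _ eq))
              , λ (μ , μ∈B) → let w , eq = B⇒monomial μ μ∈B in
                  from w , λ i≡ → trans (cong monomial (inverseˡ i≡)) eq
  }
  where
  e : Fin (W m 0) ↔ WeightedPath m 0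
  e = Fin-W↔WeightedPath m 0
  open Inverse e using (to; from; inverseˡ)
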